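{- Every connected, nonhamiltonian, locally linear graph with at least $3$ vertices has at least $12$ vertices, and there exists a connected, nonhamiltonian, locally linear graph with exactly $12$ vertices. That is, the minimum order of a nonhamiltonian locally linear graph is $12$.
   Context: All graphs are finite, simple and connected. For a vertex $v$ of a graph $G$, $N(v)$ is the set of neighbours of $v$ and $G[S]$ is the subgraph induced by a vertex set $S$. A graph $G$ is locally linear if for every vertex $v$ of $G$ the induced subgraph $G[N(v)]$ is a path. A graph is hamiltonian if it contains a cycle through all of its vertices. -}

module Defs where

open import Data.Nat using (ℕ; zero; suc; _≤_; _+_)
open import Data.Fin using (Fin; toℕ)
open import Data.Bool using (Bool; T)
open import Data.Product using (Σ; _×_; ∃-syntax)
open import Data.Sum using (_⊎_)
open import Function.Definitions using (Injective)
open import Relation.Binary.PropositionalEquality using (_≡_)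
open import Relation.Nullary using (¬_)
open import Function.Bundles using (_⇔_)

record Graph (n : ℕ) : Set where
  field
    adj     : Fin n → Fin n → Bool
    sym     : ∀ u v → adj u v ≡ adj v u
    irrefl  : ∀ v → adj v v ≡ Data.Bool.false

open Graph public

Adj : ∀ {n} → Graph n → Fin n → Fin n → Set
Adj G u v = T (adj G u v)

data Walk {n : ℕ} (G : Graph n) : Fin n → Fin n → Set where
  here : ∀ {u} → Walk G u u
  step : ∀ {u w v} → Adj G u w → Walk G w v → Walk G u v

Connected : ∀ {n} → Graph n → Set
Connected G = ∀ u v → Walk G u v

InNbhd : ∀ {n} → Graph n → Fin n → Fin n → Set
InNbhd G v u = Adj G v u

Consecutive : ℕ → ℕ → Set
Consecutive i j = (suc i ≡ j) ⊎ (suc j ≡ i)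

NbhdIsPath : ∀ {n} → Graph n → Fin n → Set
NbhdIsPath {n} G v =
  Σ ℕ λ k → 1 ≤ k × Σ (Fin k → Fin n) λ f →
    Injective _≡_ _≡_ f
    × (∀ u → InNbhd G v u ⇔ (∃[ i ] f i ≡ u))
    × (∀ i j → Adj G (f i) (f j) ⇔ Consecutive (toℕ i) (toℕ j))

LocallyLinear : ∀ {n} → Graph n → Set
LocallyLinear G = ∀ v → NbhdIsPath G v

Hamiltonian : ∀ {n} → Graph n → Set
Hamiltonian {n} G =
  3 ≤ n × Σ (Fin n → Fin n) λ c →
    Injective _≡_ _≡_ c
    × (∀ i j → suc (toℕ i) ≡ toℕ j → Adj G (c i) (c j))
    × (∀ i j → toℕ i ≡ 0 → suc (toℕ j) ≡ n → Adj G (c j) (c i))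

{-# OPTIONS --safe #-}
-- A locally linear graph is a triangulated surface with every vertex on the boundary: the two ends
-- of the path G[N(v)] are the boundary neighbours of v, and the boundary edges are the edges lying
-- in only one triangle.  They form disjoint cycles through all vertices, each of length at least 4
-- unless it is the whole graph.  One boundary cycle is a Hamilton cycle, and three need 12 vertices.
-- Two boundary cycles merge into a Hamilton cycle as soon as boundary edges xx′ and yy′ on different
-- cycles have xy and x′y′ as edges.  For lengths a + b ≤ 11 a merge cannot be avoided: starting from
-- one edge between the cycles, repeatedly branch over the apex of a missing triangle.
--
-- The extremal graph is an antiprism on two squares, one of which carries an ear (a vertex of degree
-- 2) on each of its edges: a Hamilton cycle would use both edges at every ear, and these eight edges
-- already close up.
module Submission where

open import Defs
open import Data.Bool using (Bool; true; false; T; not; _∧_; _∨_; _xor_; if_then_else_)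
open import Data.Bool.ListAction using (all; any)
open import Data.Bool.Properties using (T-∧; T-∨)
import Data.Bool.Properties as Bool
open import Data.Empty using (⊥)
open import Data.Fin using (Fin; zero; suc; toℕ; fromℕ<; #_)
import Data.Fin.Properties as Fin
open import Data.List using (List; []; _∷_; map; concatMap; filterᵇ; upTo; applyUpTo; allFin; length)
import Data.List as List
open import Data.List.Membership.Propositional using (_∈_; _∉_; find)
open import Data.List.Membership.Propositional.Properties using (∈-filter⁻; ∈-upTo⁺; ∈-map⁻; ∈-concatMap⁻; ∈-allFin)
open import Data.List.Relation.Unary.All using (lookup)
open import Data.List.Relation.Unary.All.Properties using (all⁺)
open import Data.List.Relation.Unary.Any using (here; there)
import Data.List.Relation.Unary.Any as Any
open import Data.List.Relation.Unary.Any.Properties using (any⁺; any⁻)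
open import Data.Nat
open import Data.Nat.Properties
open import Data.Product using (Σ; ∃; ∃₂; _×_; _,_; proj₁; proj₂)
open import Data.Sum using (_⊎_; inj₁; inj₂; [_,_]′)
import Data.Sum as Sum
open import Data.Vec using (Vec; []; _∷_)
import Data.Vec as Vec
open import Function using (_∘_)
open import Function.Bundles using (Equivalence; mk⇔)
open import Relation.Binary.Definitions using (tri<; tri≈; tri>)
open import Relation.Binary.PropositionalEquality using (_≡_; _≢_; refl; trans; cong; subst; subst₂) renaming (sym to ≡-sym)
open import Relation.Nullary using (¬_; Dec; yes; no; contradiction)
open import Relation.Nullary.Decidable using (T?; _⊎-dec_; _→-dec_; toWitness)

-- Search for a contradiction in a partial graph with two boundary cycles.

_∈ᵇ_ : ℕ → List ℕ → Bool
x ∈ᵇ xs = any (x ≡ᵇ_) xs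

-- Row u lists the neighbours of u found so far; non-edges are not recorded.
State : Set
State = List (List ℕ)

row : State → ℕ → List ℕ
row []       _       = []
row (r ∷ _)  zero    = r
row (_ ∷ rs) (suc u) = row rs u

insert : ℕ → ℕ → State → State
insert _       _ []       = []
insert zero    w (r ∷ rs) = (if w ∈ᵇ r then r else w ∷ r) ∷ rs
insert (suc u) w (r ∷ rs) = r ∷ insert u w rs

link : ℕ → ℕ → State → State
link u w S = insert u w (insert w u S)

common : State → ℕ → ℕ → List ℕ
common S u v = filterᵇ (_∈ᵇ row S v) (row S u)

-- In overfull and deficient the Boolean tells whether the edge is a boundary edge, and the list
-- holds the apices of the triangles found on it: a boundary edge has one, any other edge has two.
overfull : Bool → List ℕ → Bool
overfull true  (x ∷ y ∷ _)     = not (x ≡ᵇ y)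
overfull false (x ∷ y ∷ z ∷ _) = not (x ≡ᵇ y) ∧ not (x ≡ᵇ z) ∧ not (y ≡ᵇ z)
overfull _     _               = false

deficient : Bool → List ℕ → Bool
deficient _     []       = true
deficient false (_ ∷ []) = true
deficient _     _        = false

-- Follows the link of v, coming from x to y, until it gets back to s.
returns : ℕ → State → ℕ → ℕ → ℕ → ℕ → Bool
returnsVia : ℕ → State → ℕ → ℕ → ℕ → List ℕ → Bool
returns zero    S v s x y = false
returns (suc k) S v s x y = returnsVia k S v s y (filterᵇ (λ z → not (z ≡ᵇ x)) (common S v y))
returnsVia k S v s y []      = false
-- Only one continuation is followed: an edge has at most two apices unless the state is crowded,
-- and the apex `x` of `v y` has been removed.
returnsVia k S v s y (z ∷ _) = (z ≡ᵇ s) ∨ returns k S v s y z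

-- The boundary cycles are 0, …, a - 1 and a, …, a + b - 1.
module _ (a b : ℕ) where

  nextLabel prevLabel : ℕ → ℕ
  nextLabel u = if suc u ≡ᵇ a then 0 else (if suc u ≡ᵇ a + b then a else suc u)
  prevLabel zero    = a ∸ 1
  prevLabel (suc u) = if suc u ≡ᵇ a then a + b ∸ 1 else u

  sides : ℕ → List ℕ
  sides u = nextLabel u ∷ prevLabel u ∷ []

  side : ℕ → ℕ → Bool
  side u v = v ∈ᵇ sides u

  crowded : State → ℕ → ℕ → Bool
  crowded S u v = overfull (side u v) (common S u v)

  -- A link has fewer than `a + b` vertices, so the fuel is enough for going round it once.
  loops : State → ℕ → ℕ → Bool
  loops S v s = any (returns (a + b) S v s s) (common S v s)

  -- For a recorded edge `u v`, this is the configuration that joins the two cycles into a Hamilton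
  -- cycle: boundary edges `u u′` and `v v′` on different cycles, with `u′ v′` recorded as well.
  mergeable : State → ℕ → ℕ → Bool
  mergeable S u v = ((u <ᵇ a) xor (v <ᵇ a)) ∧
    any (λ u′ → any (_∈ᵇ row S u′) (sides v)) (sides u)

  -- All triangles completed by the latest edges contain w, so it suffices to look around w.
  contradictory : State → ℕ → Bool
  contradictory S w = any (mergeable S w) (row S w)
    ∨ any (crowded S w) (row S w)
    ∨ any (λ z → any (crowded S z) (common S w z)) (row S w)
    ∨ any (λ z → loops S z w) (row S w)
    ∨ any (loops S w) (row S w)

  edges : State → List (ℕ × ℕ)
  edges S = concatMap (λ u → map (u ,_) (row S u)) (upTo (a + b))

  lacksTriangle : State → ℕ × ℕ → Bool
  lacksTriangle S (u , v) = deficient (side u v) (common S u v)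

  -- Depth-first search with depth bound `k`, branching over all labels for a missing apex of the
  -- first edge that lacks one. The value `false` only means that the search has given up.
  refute : ℕ → State → Bool
  refuteFirst : ℕ → State → List (ℕ × ℕ) → Bool
  refuteApex : ℕ → State → ℕ → ℕ → ℕ → Bool
  refute zero    S = false
  refute (suc k) S = refuteFirst k S (filterᵇ (lacksTriangle S) (edges S))
  refuteFirst k S []            = false
  refuteFirst k S ((u , v) ∷ _) = all (refuteApex k S u v) (upTo (a + b))
  refuteApex k S u v w = w ∈ᵇ (u ∷ v ∷ common S u v) ∨ contradictory S′ w ∨ refute k S′
    where S′ = link u w (link v w S)

  -- Either cycle can be labelled from any of its vertices, so a given edge between the cycles can
  -- be taken to join 0 and `a`.
  start : State
  start = link 0 a (applyUpTo sides (a + b))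

-- Soundness of the search.

T-∨⁻ : ∀ {x y} → T (x ∨ y) → T x ⊎ T y
T-∨⁻ = Equivalence.to T-∨

T-∧⁻ : ∀ {x y} → T (x ∧ y) → T x × T y
T-∧⁻ = Equivalence.to T-∧

T-not⁻ : ∀ {x} → T (not x) → ¬ T x
T-not⁻ {false} _ ()

≢ᵇ⇒≢ : ∀ {x y} → T (not (x ≡ᵇ y)) → x ≢ y
≢ᵇ⇒≢ {x} t refl = T-not⁻ t (≡⇒≡ᵇ x x refl)

∈ᵇ⇒∈ : ∀ {x} xs → T (x ∈ᵇ xs) → x ∈ xs
∈ᵇ⇒∈ xs t = Any.map (≡ᵇ⇒≡ _ _) (any⁻ _ xs t)

∈⇒∈ᵇ : ∀ {x xs} → x ∈ xs → T (x ∈ᵇ xs)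
∈⇒∈ᵇ x∈xs = any⁺ _ (Any.map (≡⇒≡ᵇ _ _) x∈xs)

any⇒∃ : ∀ {A : Set} (p : A → Bool) xs → T (any p xs) → ∃ λ x → x ∈ xs × T (p x)
any⇒∃ p xs t = find (any⁻ p xs t)

∈-filterᵇ⁻ : ∀ {A : Set} (p : A → Bool) {xs x} → x ∈ filterᵇ p xs → x ∈ xs × T (p x)
∈-filterᵇ⁻ p = ∈-filter⁻ (T? ∘ p)

∈-insert⁻ : ∀ u w S {x v} → v ∈ row (insert u w S) x → v ∈ row S x ⊎ (x ≡ u × v ≡ w)
∈-insert⁻ zero    w (r ∷ S) {zero} v∈ with w ∈ᵇ r
∈-insert⁻ zero    w (r ∷ S) {zero} v∈           | true  = inj₁ v∈
∈-insert⁻ zero    w (r ∷ S) {zero} (here refl)  | false = inj₂ (refl , refl)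
∈-insert⁻ zero    w (r ∷ S) {zero} (there v∈)   | false = inj₁ v∈
∈-insert⁻ zero    w (r ∷ S) {suc x} v∈ = inj₁ v∈
∈-insert⁻ (suc u) w (r ∷ S) {zero}  v∈ = inj₁ v∈
∈-insert⁻ (suc u) w (r ∷ S) {suc x} v∈ with ∈-insert⁻ u w S {x} v∈
... | inj₁ v∈S          = inj₁ v∈S
... | inj₂ (refl , v≡w) = inj₂ (refl , v≡w)

∈-row-applyUpTo⁻ : ∀ (f : ℕ → List ℕ) n {u v} → v ∈ row (applyUpTo f n) u → u < n × v ∈ f u
∈-row-applyUpTo⁻ f (suc n) {zero}  v∈ = s≤s z≤n , v∈
∈-row-applyUpTo⁻ f (suc n) {suc u} v∈ with ∈-row-applyUpTo⁻ (f ∘ suc) n {u} v∈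
... | u<n , v∈fu = s≤s u<n , v∈fu

-- Non-backtracking walks in the link of `v`. The last three indices are the first vertex, the last
-- vertex but one and the last vertex.
data LinkWalk {V : Set} (_~_ : V → V → Set) (v s : V) : V → V → Set where
  depart : ∀ {x} → v ~ s → v ~ x → s ~ x → LinkWalk _~_ v s s x
  extend : ∀ {x y z} → LinkWalk _~_ v s x y → v ~ z → y ~ z → z ≢ x → LinkWalk _~_ v s y z

-- What the search relies on, stated for labels. Here `_~_` is the complete adjacency relation, of
-- which a `State` records only a part.
record TwoCycleModel (a b : ℕ) (_~_ : ℕ → ℕ → Set) : Set where
  field
    ~-sym       : ∀ {u v} → u ~ v → v ~ u
    ~-irrefl    : ∀ {u} → ¬ u ~ u
    ~-bound     : ∀ {u v} → u ~ v → v < a + b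
    side-~      : ∀ {u v} → u < a + b → v ∈ sides a b u → u ~ v
    start-~     : 0 ~ a
    apex        : ∀ {u v} → u ~ v → ∃ λ w → u ~ w × v ~ w
    apex-other  : ∀ {u v} → u ~ v → v ∉ sides a b u → ∀ w → ∃ λ w′ → w ≢ w′ × u ~ w′ × v ~ w′
    side-apex   : ∀ {u v w w′} → u ~ v → v ∈ sides a b u → u ~ w → v ~ w → u ~ w′ → v ~ w′ → w ≡ w′
    two-apices  : ∀ {u v x y z} → u ~ v → u ~ x → v ~ x → u ~ y → v ~ y → u ~ z → v ~ z →
                  x ≢ y → x ≢ z → y ≢ z → ⊥
    link-acyclic : ∀ {v s x y} → LinkWalk _~_ v s x y → y ≢ s
    unmergeable : ∀ {u v u′ v′} → T ((u <ᵇ a) xor (v <ᵇ a)) → u ~ v →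
                  u′ ∈ sides a b u → v′ ∈ sides a b v → u′ ~ v′ → ⊥

module Soundness {a b : ℕ} {_~_ : ℕ → ℕ → Set} (M : TwoCycleModel a b _~_) where
  open TwoCycleModel M

  -- Containment in the graph is the whole invariant: every contradiction the search reports arises
  -- from edges that are present, never from absent ones.
  Valid : State → Set
  Valid S = ∀ {u v} → v ∈ row S u → u ~ v

  link-valid : ∀ {S u w} → u ~ w → Valid S → Valid (link u w S)
  link-valid {S} {u} {w} u~w ok v∈ with ∈-insert⁻ u w (insert w u S) v∈
  ... | inj₂ (refl , refl) = u~w
  ... | inj₁ v∈′ with ∈-insert⁻ w u S v∈′
  ...   | inj₂ (refl , refl) = ~-sym u~w
  ...   | inj₁ v∈S           = ok v∈S

  start-valid : Valid (start a b)
  start-valid = link-valid {applyUpTo (sides a b) (a + b)} start-~ λ v∈ →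
    let u<n , v∈sides = ∈-row-applyUpTo⁻ (sides a b) (a + b) v∈ in side-~ u<n v∈sides

  new-apex : ∀ {u v} → u ~ v → ∀ ws c → (v ∈ sides a b u → T c) → T (deficient c ws) →
             ∃ λ w → w ∉ ws × u ~ w × v ~ w
  new-apex u~v []       c     ∈c t = let w , p = apex u~v in w , (λ ()) , p
  -- At `false` the hypothesis `∈c` is a proof that `v` is not in `sides a b u`, so a second apex
  -- exists.
  new-apex u~v (x ∷ []) false ∈c t =
    let w , x≢w , p = apex-other u~v ∈c x in w , (λ { (here w≡x) → x≢w (≡-sym w≡x) }) , p

  module _ {S : State} (ok : Valid S) where

    common-~ : ∀ {u v w} → w ∈ common S u v → u ~ w × v ~ w
    common-~ {u} {v} w∈ with ∈-filterᵇ⁻ (_∈ᵇ row S v) {row S u} w∈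
    ... | w∈u , w∈v = ok w∈u , ok (∈ᵇ⇒∈ (row S v) w∈v)

    overfull-sound : ∀ {u v} → u ~ v → ∀ ws → (∀ {w} → w ∈ ws → u ~ w × v ~ w) →
                      ∀ c → (T c → v ∈ sides a b u) → T (overfull c ws) → ⊥
    overfull-sound u~v (x ∷ y ∷ _) ap true v∈ t
      with ap (here refl) | ap (there (here refl))
    ... | u~x , v~x | u~y , v~y = ≢ᵇ⇒≢ t (side-apex u~v (v∈ _) u~x v~x u~y v~y)
    overfull-sound u~v (x ∷ y ∷ z ∷ _) ap false v∈ t
      with ap (here refl) | ap (there (here refl)) | ap (there (there (here refl)))
         | T-∧⁻ {not (x ≡ᵇ y)} t
    ... | u~x , v~x | u~y , v~y | u~z , v~z | t₁ , t₂ with T-∧⁻ {not (x ≡ᵇ z)} t₂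
    ...   | t₃ , t₄ = two-apices u~v u~x v~x u~y v~y u~z v~z (≢ᵇ⇒≢ t₁) (≢ᵇ⇒≢ t₃) (≢ᵇ⇒≢ t₄)

    crowded-sound : ∀ {u v} → u ~ v → T (crowded a b S u v) → ⊥
    crowded-sound {u} {v} u~v =
      overfull-sound u~v (common S u v) common-~ (side a b u v) (∈ᵇ⇒∈ (sides a b u))

    -- Each round of the computation extends a `LinkWalk`, and `link-acyclic` keeps such a walk from
    -- getting back to `s`.
    returns-sound : ∀ k {v s x y} → LinkWalk _~_ v s x y → T (returns k S v s x y) → ⊥
    returnsVia-sound : ∀ k {v s x y} → LinkWalk _~_ v s x y →
      ∀ zs → (∀ {z} → z ∈ zs → z ≢ x × v ~ z × y ~ z) → T (returnsVia k S v s y zs) → ⊥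
    returns-sound (suc k) {v} {s} {x} {y} walk = returnsVia-sound k walk _ λ z∈ →
      let z∈common , z≢x = ∈-filterᵇ⁻ (λ z → not (z ≡ᵇ x)) {common S v y} z∈
      in ≢ᵇ⇒≢ z≢x , common-~ z∈common
    returnsVia-sound k walk (z ∷ _) next t with next (here refl)
    ... | z≢x , v~z , y~z with T-∨⁻ {z ≡ᵇ _} t
    ...   | inj₁ z≡s = link-acyclic (extend walk v~z y~z z≢x) (≡ᵇ⇒≡ _ _ z≡s)
    ...   | inj₂ t′  = returns-sound k (extend walk v~z y~z z≢x) t′

    loops-sound : ∀ {v s} → v ~ s → T (loops a b S v s) → ⊥
    loops-sound {v} {s} v~s t with any⇒∃ _ (common S v s) t
    ... | x , x∈ , t′ with common-~ x∈
    ...   | v~x , s~x = returns-sound (a + b) (depart v~s v~x s~x) t′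

    mergeable-sound : ∀ {u v} → u ~ v → T (mergeable a b S u v) → ⊥
    mergeable-sound {u} {v} u~v t with T-∧⁻ {(u <ᵇ a) xor (v <ᵇ a)} t
    ... | opposite , t₁ with any⇒∃ _ (sides a b u) t₁
    ...   | u′ , u′∈ , t₂ with any⇒∃ (_∈ᵇ row S u′) (sides a b v) t₂
    ...     | v′ , v′∈ , t₃ = unmergeable opposite u~v u′∈ v′∈ (ok (∈ᵇ⇒∈ (row S u′) t₃))

    contradictory-sound : ∀ w → T (contradictory a b S w) → ⊥
    contradictory-sound w t with T-∨⁻ {any (mergeable a b S w) (row S w)} t
    ... | inj₁ t₁ = let _ , z∈ , t′ = any⇒∃ _ (row S w) t₁ in mergeable-sound (ok z∈) t′
    ... | inj₂ t₁ with T-∨⁻ {any (crowded a b S w) (row S w)} t₁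
    ...   | inj₁ t₂ = let _ , z∈ , t′ = any⇒∃ _ (row S w) t₂ in crowded-sound (ok z∈) t′
    ...   | inj₂ t₂ with T-∨⁻ {any (λ z → any (crowded a b S z) (common S w z)) (row S w)} t₂
    ...     | inj₁ t₃ =
      let z , z∈ , t′ = any⇒∃ _ (row S w) t₃
          y , y∈ , t″ = any⇒∃ (crowded a b S z) (common S w z) t′
      in crowded-sound (proj₂ (common-~ y∈)) t″
    ...     | inj₂ t₃ with T-∨⁻ {any (λ z → loops a b S z w) (row S w)} t₃
    ...       | inj₁ t₄ = let _ , z∈ , t′ = any⇒∃ _ (row S w) t₄ in loops-sound (~-sym (ok z∈)) t′
    ...       | inj₂ t₄ = let _ , z∈ , t′ = any⇒∃ _ (row S w) t₄ in loops-sound (ok z∈) t′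

    edges-~ : ∀ {u v} → (u , v) ∈ edges a b S → u ~ v
    edges-~ e∈ with find (∈-concatMap⁻ _ {xs = upTo (a + b)} e∈)
    ... | u , _ , e∈u with ∈-map⁻ (u ,_) e∈u
    ...   | _ , v∈ , refl = ok v∈

  -- The chosen edge has an apex `w` that is not yet recorded. It is among the labels tried, and
  -- adding its two edges keeps the state valid, so its branch cannot have been refuted.
  refute-sound : ∀ k {S} → Valid S → T (refute a b k S) → ⊥
  refuteFirst-sound : ∀ k {S} → Valid S → ∀ es →
    (∀ {u v} → (u , v) ∈ es → u ~ v × T (lacksTriangle a b S (u , v))) → T (refuteFirst a b k S es) → ⊥
  refuteApex-sound : ∀ k {S u v w} → Valid S → u ~ w → v ~ w → w ∉ common S u v →
    T (refuteApex a b k S u v w) → ⊥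
  refute-sound (suc k) {S} ok = refuteFirst-sound k {S} ok _ λ e∈ →
    let e∈edges , lacks = ∈-filterᵇ⁻ (lacksTriangle a b S) {edges a b S} e∈
    in edges-~ {S} ok e∈edges , lacks
  refuteFirst-sound k {S} ok ((u , v) ∷ es) lacking t with lacking (here refl)
  ... | u~v , lacks with new-apex u~v (common S u v) (side a b u v) ∈⇒∈ᵇ lacks
  ...   | w , w∉ , u~w , v~w = refuteApex-sound k {S} ok u~w v~w w∉
    (lookup (all⁺ (refuteApex a b k S u v) (upTo (a + b)) t) (∈-upTo⁺ (~-bound u~w)))
  refuteApex-sound k {S} {u} {v} {w} ok u~w v~w w∉ t
    with T-∨⁻ {w ∈ᵇ (u ∷ v ∷ common S u v)} t
  ... | inj₁ w∈ with ∈ᵇ⇒∈ {w} (u ∷ v ∷ common S u v) w∈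
  ...   | here refl          = ~-irrefl u~w
  ...   | there (here refl)  = ~-irrefl v~w
  ...   | there (there w∈′)  = w∉ w∈′
  refuteApex-sound k {S} {u} {v} {w} ok u~w v~w w∉ t | inj₂ t′
    with T-∨⁻ {contradictory a b (link u w (link v w S)) w} t′
  ... | inj₁ bad  = contradictory-sound {link u w (link v w S)}
    (link-valid {link v w S} u~w (link-valid {S} v~w ok)) w bad
  ... | inj₂ rest = refute-sound k {link u w (link v w S)}
    (link-valid {link v w S} u~w (link-valid {S} v~w ok)) rest

-- Neighbourhood paths.

Adj-sym : ∀ {n} (G : Graph n) {u v} → Adj G u v → Adj G v u
Adj-sym G {u} {v} = subst T (Graph.sym G u v)

Adj-irrefl : ∀ {n} (G : Graph n) {v} → ¬ Adj G v v
Adj-irrefl G {v} = subst T (irrefl G v)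

-- The path around `v` with natural numbers as positions. Relating positions to vertices by `At`
-- allows matching on `zero` and `suc` instead of computing with `Fin` indices.
record Fan {n} (G : Graph n) (v : Fin n) : Set₁ where
  field
    size          : ℕ
    nonempty      : 0 < size
    At            : ℕ → Fin n → Set
    at-bound      : ∀ {i x} → At i x → i < size
    at-nbr        : ∀ {i x} → At i x → Adj G v x
    nbr-at        : ∀ {x} → Adj G v x → ∃ λ i → At i x
    at-total      : ∀ {i} → i < size → ∃ (At i)
    at-functional : ∀ {i x y} → At i x → At i y → x ≡ y
    at-injective  : ∀ {i j x} → At i x → At j x → i ≡ j
    at-adj        : ∀ {i j x y} → At i x → At j y → Consecutive i j → Adj G x y
    adj-at        : ∀ {i j x y} → At i x → At j y → Adj G x y → Consecutive i j

fan : ∀ {n} {G : Graph n} {v} → NbhdIsPath G v → Fan G v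
fan {G = G} (k , 1≤k , f , f-inj , nbr , path) = record
  { size          = k
  ; nonempty      = 1≤k
  ; At            = λ i x → Σ (Fin k) λ j → toℕ j ≡ i × f j ≡ x
  ; at-bound      = λ { (j , refl , _) → Fin.toℕ<n j }
  ; at-nbr        = λ { (j , _ , eq) → Equivalence.from (nbr _) (j , eq) }
  ; nbr-at        = λ v~x → let j , eq = Equivalence.to (nbr _) v~x in toℕ j , j , refl , eq
  ; at-total      = λ i<k → f (fromℕ< i<k) , fromℕ< i<k , Fin.toℕ-fromℕ< i<k , refl
  ; at-functional = λ { (j , refl , refl) (j′ , eq , refl) → cong f (Fin.toℕ-injective (≡-sym eq)) }
  ; at-injective  = λ { (j , refl , refl) (j′ , refl , eq) → cong toℕ (f-inj (≡-sym eq)) }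
  ; at-adj        = λ { (j , refl , refl) (j′ , refl , refl) → Equivalence.from (path j j′) }
  ; adj-at        = λ { (j , refl , refl) (j′ , refl , refl) → Equivalence.to (path j j′) }
  }

-- Walking on the integers in unit steps, one changes direction only by returning to the previous
-- number. The primed version is for descending walks.
Consecutive-step : ∀ {i j l} → Consecutive i l → Consecutive j l → j ≢ i → i < l → l < j
Consecutive-step (inj₁ refl) (inj₁ refl) j≢i _ = contradiction refl j≢i
Consecutive-step (inj₁ refl) (inj₂ refl) j≢i _ = n<1+n _
Consecutive-step (inj₂ refl) _           j≢i i<l = contradiction i<l (<⇒≯ (n<1+n _))

Consecutive-step′ : ∀ {i j l} → Consecutive i l → Consecutive j l → j ≢ i → l < i → j < l
Consecutive-step′ (inj₂ refl) (inj₂ refl) j≢i _ = contradiction refl j≢i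
Consecutive-step′ (inj₂ refl) (inj₁ refl) j≢i _ = n<1+n _
Consecutive-step′ (inj₁ refl) _           j≢i l<i = contradiction l<i (<⇒≯ (n<1+n _))

Consecutive⇒<⊎> : ∀ {i j} → Consecutive i j → i < j ⊎ j < i
Consecutive⇒<⊎> (inj₁ refl) = inj₁ (n<1+n _)
Consecutive⇒<⊎> (inj₂ refl) = inj₂ (n<1+n _)

Consecutive-sym : ∀ {i j} → Consecutive i j → Consecutive j i
Consecutive-sym (inj₁ eq) = inj₂ eq
Consecutive-sym (inj₂ eq) = inj₁ eq

Closed : ∀ {n} (G : Graph n) → (Fin n → Set) → Set
Closed G X = ∀ {u v} → X u → Adj G u v → X v

Closed-walk : ∀ {n} {G : Graph n} {X u v} → Closed G X → Walk G u v → X u → X v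
Closed-walk cl here         Xu = Xu
Closed-walk cl (step u~w p) Xu = Closed-walk cl p (cl Xu u~w)

leaves-set : ∀ {n} {G : Graph n} {X : Fin n → Set} → (∀ x → Dec (X x)) → ∀ {u v} → Walk G u v →
             X u → ¬ X v → ∃₂ λ x y → X x × ¬ X y × Adj G x y
leaves-set X? here Xu ¬Xv = contradiction Xu ¬Xv
leaves-set X? (step {u} {w} u~w p) Xu ¬Xv with X? w
... | yes Xw = leaves-set X? p Xw ¬Xv
... | no ¬Xw = u , w , Xu , ¬Xw , u~w

-- Sequences of distinct vertices and Hamilton cycles.

InjectiveBelow : ∀ {A : Set} → ℕ → (ℕ → A) → Set
InjectiveBelow m f = ∀ {i j} → i < m → j < m → f i ≡ f j → i ≡ j

CoversBelow : ∀ {A : Set} → ℕ → (ℕ → A) → A → Set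
CoversBelow m f x = ∃ λ i → i < m × f i ≡ x

injectiveBelow⇒≤ : ∀ {n m} {f : ℕ → Fin n} → InjectiveBelow m f → m ≤ n
injectiveBelow⇒≤ {f = f} inj = Fin.injective⇒≤ {f = f ∘ toℕ} λ eq →
  Fin.toℕ-injective (inj (Fin.toℕ<n _) (Fin.toℕ<n _) eq)

covers⇒≤ : ∀ {n m} {f : ℕ → Fin n} → (∀ x → CoversBelow m f x) → n ≤ m
covers⇒≤ {n} {m} {f} cov = Fin.injective⇒≤ {f = index} λ {x} {y} eq →
  trans (≡-sym (value x)) (trans (cong (f ∘ toℕ) eq) (value y))
  where
  index : Fin n → Fin m
  index x = fromℕ< (proj₁ (proj₂ (cov x)))
  value : ∀ x → f (toℕ (index x)) ≡ x
  value x = trans (cong f (Fin.toℕ-fromℕ< _)) (proj₂ (proj₂ (cov x)))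

coversBelow? : ∀ {n} m (f : ℕ → Fin n) x → Dec (CoversBelow m f x)
coversBelow? m f x = anyUpTo? (λ i → f i Fin.≟ x) m

m≮n⇒m∸n<o : ∀ {m n o} → m < n + o → m ≮ n → m ∸ n < o
m≮n⇒m∸n<o {m} {n} {o} m<n+o m≮n = subst (m ∸ n <_) (m+n∸m≡n n o) (∸-monoˡ-< m<n+o (≮⇒≥ m≮n))

splice : ∀ {A : Set} → ℕ → (ℕ → A) → (ℕ → A) → ℕ → A
splice a p q i with i <? a
... | yes _ = p i
... | no  _ = q (i ∸ a)

module _ {A : Set} {a : ℕ} {p q : ℕ → A} where

  splice-< : ∀ {i} → i < a → splice a p q i ≡ p i
  splice-< {i} i<a with i <? a
  ... | yes _  = refl
  ... | no i≮a = contradiction i<a i≮a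

  splice-≥ : ∀ {i} → a ≤ i → splice a p q i ≡ q (i ∸ a)
  splice-≥ {i} a≤i with i <? a
  ... | yes i<a = contradiction i<a (≤⇒≯ a≤i)
  ... | no  _   = refl

  splice-+ : ∀ j → splice a p q (a + j) ≡ q j
  splice-+ j = trans (splice-≥ (m≤m+n a j)) (cong q (m+n∸m≡n a j))

  splice-injective : ∀ {b} → InjectiveBelow a p → InjectiveBelow b q →
                     (∀ {i j} → i < a → j < b → p i ≢ q j) → InjectiveBelow (a + b) (splice a p q)
  splice-injective {b} p-inj q-inj disj {i} {j} i<n j<n eq with i <? a | j <? a
  ... | yes i<a | yes j<a = p-inj i<a j<a eq
  ... | yes i<a | no j≮a  = contradiction eq (disj i<a (m≮n⇒m∸n<o j<n j≮a))
  ... | no i≮a  | yes j<a = contradiction (≡-sym eq) (disj j<a (m≮n⇒m∸n<o i<n i≮a))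
  ... | no i≮a  | no j≮a  = ∸-cancelʳ-≡ (≮⇒≥ i≮a) (≮⇒≥ j≮a)
    (q-inj (m≮n⇒m∸n<o i<n i≮a) (m≮n⇒m∸n<o j<n j≮a) eq)

  splice-coversˡ : ∀ {b x} → CoversBelow a p x → CoversBelow (a + b) (splice a p q) x
  splice-coversˡ (i , i<a , eq) = i , <-≤-trans i<a (m≤m+n a _) , trans (splice-< i<a) eq

  splice-coversʳ : ∀ {b x} → CoversBelow b q x → CoversBelow (a + b) (splice a p q) x
  splice-coversʳ (j , j<b , eq) = a + j , +-monoʳ-< a j<b , trans (splice-+ j) eq

hamiltonian : ∀ {n} {G : Graph n} → 3 ≤ n → (h : ℕ → Fin n) → InjectiveBelow n h →
  (∀ {i} → suc i < n → Adj G (h i) (h (suc i))) → (∀ {m} → suc m ≡ n → Adj G (h m) (h 0)) → Hamiltonian G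
hamiltonian {n} {G} 3≤n h inj next close = 3≤n , h ∘ toℕ
  , (λ eq → Fin.toℕ-injective (inj (Fin.toℕ<n _) (Fin.toℕ<n _) eq))
  , (λ i j eq → subst (λ m → Adj G (h (toℕ i)) (h m)) eq (next (subst (_< n) (≡-sym eq) (Fin.toℕ<n j))))
  , (λ i j i≡0 eq → subst (λ m → Adj G (h (toℕ j)) (h m)) (≡-sym i≡0) (close eq))

-- Boundary edges.

module Boundary {n : ℕ} (G : Graph n) (fans : ∀ v → Fan G v)
                (apex : ∀ {u v} → Adj G u v → ∃ λ w → Adj G u w × Adj G v w) where

  _~_ : Fin n → Fin n → Set
  _~_ = Adj G

  -- A boundary edge lies in exactly one triangle. Uniqueness is asked here, and existence is the
  -- hypothesis `apex`.
  Side : Fin n → Fin n → Set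
  Side u v = u ~ v × (∀ {w w′} → u ~ w → v ~ w → u ~ w′ → v ~ w′ → w ≡ w′)

  side-sym : ∀ {u v} → Side u v → Side v u
  side-sym (u~v , one) = Adj-sym G u~v , λ a b c d → one b a d c

  side-≢ : ∀ {u v} → Side u v → u ≢ v
  side-≢ (u~v , _) refl = Adj-irrefl G u~v

  module _ {v : Fin n} where
    open Fan (fans v)

    link-consecutive : ∀ {i x w} → At i x → v ~ w → x ~ w → ∃ λ j → At j w × Consecutive i j
    link-consecutive at-x v~w x~w with nbr-at v~w
    ... | j , at-w = j , at-w , adj-at at-x at-w x~w

    -- The apex over the edge to the first vertex of the path is a second vertex of the path.
    size>1 : 1 < size
    size>1 with at-total nonempty
    ... | x , at-x with apex (at-nbr at-x)
    ...   | w , v~w , x~w with link-consecutive at-x v~w x~w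
    ...     | _ , at-w , inj₁ refl = at-bound at-w

    -- An end of the path has only one neighbour on the path, and apices of `v x` are neighbours of
    -- `x` on the path around `v`.
    first-side : ∀ {x} → At 0 x → Side v x
    first-side at-x = at-nbr at-x , one
      where
      one : ∀ {w w′} → v ~ w → _ ~ w → v ~ w′ → _ ~ w′ → w ≡ w′
      one v~w x~w v~w′ x~w′ with link-consecutive at-x v~w x~w | link-consecutive at-x v~w′ x~w′
      ... | _ , at-w , inj₁ refl | _ , at-w′ , inj₁ refl = at-functional at-w at-w′

    last-side : ∀ {i x} → suc i ≡ size → At i x → Side v x
    last-side i≡s at-x = at-nbr at-x , one
      where
      one : ∀ {w w′} → v ~ w → _ ~ w → v ~ w′ → _ ~ w′ → w ≡ w′
      one v~w x~w v~w′ x~w′ with link-consecutive at-x v~w x~w | link-consecutive at-x v~w′ x~w′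
      ... | _ , at-w , inj₂ refl | _ , at-w′ , inj₂ refl = at-functional at-w at-w′
      ... | _ , at-w , inj₁ refl | _ = contradiction i≡s (<⇒≢ (at-bound at-w))
      ... | _ | _ , at-w′ , inj₁ refl = contradiction i≡s (<⇒≢ (at-bound at-w′))

    middle : ∀ {i x} → At (suc i) x → suc (suc i) < size →
             ∃₂ λ w w′ → w ≢ w′ × (v ~ w × x ~ w) × (v ~ w′ × x ~ w′)
    middle at-x i<s with at-total (<-trans (n<1+n _) (at-bound at-x)) | at-total i<s
    ... | w , at-w | w′ , at-w′ = w , w′
      , (λ { refl → <⇒≢ (m<n⇒m<1+n (n<1+n _)) (at-injective at-w at-w′) })
      , (at-nbr at-w , at-adj at-x at-w (inj₂ refl)) , (at-nbr at-w′ , at-adj at-x at-w′ (inj₁ refl))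

    end-or-middle : ∀ {i x} → At i x → i ≡ 0 ⊎ suc i ≡ size ⊎
                    (∃₂ λ w w′ → w ≢ w′ × (v ~ w × x ~ w) × (v ~ w′ × x ~ w′))
    end-or-middle {zero}  at-x = inj₁ refl
    end-or-middle {suc i} at-x with m≤n⇒m<n∨m≡n (at-bound at-x)
    ... | inj₁ i<s = inj₂ (inj₂ (middle at-x i<s))
    ... | inj₂ i≡s = inj₂ (inj₁ i≡s)

    -- Apices of `v u` sit just before or just after `u` on the path, and these two places cannot
    -- hold three vertices.
    two-apices : ∀ {u x y z} → v ~ u → v ~ x → u ~ x → v ~ y → u ~ y → v ~ z → u ~ z →
                 x ≢ y → x ≢ z → y ≢ z → ⊥
    two-apices v~u v~x u~x v~y u~y v~z u~z x≢y x≢z y≢z with nbr-at v~u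
    ... | _ , at-u
      with link-consecutive at-u v~x u~x | link-consecutive at-u v~y u~y | link-consecutive at-u v~z u~z
    ... | _ , at-x , inj₁ refl | _ , at-y , inj₁ refl | _ = x≢y (at-functional at-x at-y)
    ... | _ , at-x , inj₁ refl | _ , at-y , inj₂ refl | _ , at-z , inj₁ refl = x≢z (at-functional at-x at-z)
    ... | _ , at-x , inj₁ refl | _ , at-y , inj₂ refl | _ , at-z , inj₂ refl = y≢z (at-functional at-y at-z)
    ... | _ , at-x , inj₂ refl | _ , at-y , inj₂ refl | _ = x≢y (at-functional at-x at-y)
    ... | _ , at-x , inj₂ refl | _ , at-y , inj₁ refl | _ , at-z , inj₁ refl = y≢z (at-functional at-y at-z)
    ... | _ , at-x , inj₂ refl | _ , at-y , inj₁ refl | _ , at-z , inj₂ refl = x≢z (at-functional at-x at-z)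

    -- Not being a boundary neighbour, `u` is an inner vertex of the path. Its two neighbours there
    -- are apices, and they cannot both be `w`.
    apex-other : ∀ {u} → v ~ u → ¬ Side v u → ∀ w → ∃ λ w′ → w ≢ w′ × v ~ w′ × u ~ w′
    apex-other v~u ¬side w with nbr-at v~u
    ... | i , at-u with end-or-middle at-u
    ... | inj₁ refl = contradiction (first-side at-u) ¬side
    ... | inj₂ (inj₁ i≡s) = contradiction (last-side i≡s at-u) ¬side
    ... | inj₂ (inj₂ (w₁ , w₂ , w₁≢w₂ , p₁ , p₂)) with w Fin.≟ w₁
    ...   | yes refl = w₂ , w₁≢w₂ , p₂
    ...   | no w≢w₁  = w₁ , w≢w₁ , p₁

    -- A non-backtracking walk in a path is monotone.
    Onward : Fin n → Fin n → Fin n → Set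
    Onward s x y = ∃₂ λ i j → ∃ λ l → At i s × At j x × At l y × Consecutive j l ×
                   ((i ≤ j × j < l) ⊎ (j ≤ i × l < j))

    linkWalk-onward : ∀ {s x y} → LinkWalk _~_ v s x y → Onward s x y
    linkWalk-onward (depart v~s v~x s~x) with nbr-at v~s
    ... | i , at-s with link-consecutive at-s v~x s~x
    ...   | l , at-x , c with Consecutive⇒<⊎> c
    ...     | inj₁ i<l = i , i , l , at-s , at-s , at-x , c , inj₁ (≤-refl , i<l)
    ...     | inj₂ l<i = i , i , l , at-s , at-s , at-x , c , inj₂ (≤-refl , l<i)
    linkWalk-onward (extend walk v~z y~z z≢x) with linkWalk-onward walk
    ... | i , j , l , at-s , at-x , at-y , c , mono with link-consecutive at-y v~z y~z
    ...   | m , at-z , c′ = i , l , m , at-s , at-y , at-z , c′ , onward mono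
      where
      m≢j : m ≢ j
      m≢j refl = z≢x (at-functional at-z at-x)
      onward : (i ≤ j × j < l) ⊎ (j ≤ i × l < j) → (i ≤ l × l < m) ⊎ (l ≤ i × m < l)
      onward (inj₁ (i≤j , j<l)) = 
        inj₁ (≤-trans i≤j (<⇒≤ j<l) , Consecutive-step c (Consecutive-sym c′) m≢j j<l)
      onward (inj₂ (j≤i , l<j)) = 
        inj₂ (≤-trans (<⇒≤ l<j) j≤i , Consecutive-step′ c (Consecutive-sym c′) m≢j l<j)

    -- The positions move strictly away from that of `s` in one direction, so none of them can
    -- recur.
    link-acyclic : ∀ {s x y} → LinkWalk _~_ v s x y → y ≢ s
    link-acyclic walk refl with linkWalk-onward walk
    ... | i , j , l , at-s , _ , at-y , _ , mono with at-injective at-s at-y | mono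
    ...   | refl | inj₁ (i≤j , j<i) = <⇒≱ j<i i≤j
    ...   | refl | inj₂ (j≤i , i<j) = <⇒≱ i<j j≤i

  record Sides (v : Fin n) : Set where
    field
      left right : Fin n
      left≢right : left ≢ right
      side-left  : Side v left
      side-right : Side v right
      only       : ∀ {x} → Side v x → x ≡ left ⊎ x ≡ right
      ear        : left ~ right → ∀ {x} → v ~ x → x ≡ left ⊎ x ≡ right

  sides-of : ∀ v → Sides v
  sides-of v with size (fans v) in eq | size>1 {v}
    where
    open Fan
  ... | suc (suc m) | s≤s (s≤s z≤n) = record
    { left = p ; right = q
    ; left≢right = λ p≡q → 0≢1+n (at-injective at-p (subst (At (suc m)) (≡-sym p≡q) at-q))
    ; side-left = first-side at-p
    ; side-right = last-side (≡-sym eq) at-q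
    ; only = only
    ; ear = ear
    }
    where
    open Fan (fans v)
    p = proj₁ (at-total nonempty)
    at-p : At 0 p
    at-p = proj₂ (at-total nonempty)
    last : ∃ (At (suc m))
    last = at-total (subst (suc m <_) (≡-sym eq) (n<1+n _))
    q = proj₁ last
    at-q : At (suc m) q
    at-q = proj₂ last
    only : ∀ {x} → Side v x → x ≡ p ⊎ x ≡ q
    only (v~x , one) with nbr-at v~x
    ... | i , at-x with end-or-middle at-x
    ... | inj₁ refl = inj₁ (at-functional at-x at-p)
    ... | inj₂ (inj₁ i≡s) = 
      inj₂ (at-functional (subst (λ j → At j _) (suc-injective (trans i≡s eq)) at-x) at-q)
    ... | inj₂ (inj₂ (_ , _ , w≢w′ , (a , b) , (c , d))) = contradiction (one a b c d) w≢w′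
    -- Adjacent ends are consecutive on the path, which therefore consists of `p` and `q` alone.
    ear : p ~ q → ∀ {x} → v ~ x → x ≡ p ⊎ x ≡ q
    ear p~q {x} v~x with nbr-at v~x | adj-at at-p at-q p~q
    ... | zero , at-x | _ = inj₁ (at-functional at-x at-p)
    ... | suc zero , at-x | inj₁ 1≡m = inj₂ (at-functional (subst (λ j → At j x) 1≡m at-x) at-q)
    ... | suc (suc i) , at-x | inj₁ 1≡m =
      contradiction (subst (suc (suc i) <_) (trans eq (cong suc (≡-sym 1≡m))) (at-bound at-x))
        (≤⇒≯ (s≤s (s≤s z≤n)))

  side-third : ∀ {v x y z} → Side v x → Side v y → x ≢ y → Side v z → z ≡ x ⊎ z ≡ y
  side-third {v} sx sy x≢y sz with only sx | only sy | only sz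
    where
    open Sides (sides-of v)
  ... | inj₁ refl | inj₁ refl | _         = contradiction refl x≢y
  ... | inj₂ refl | inj₂ refl | _         = contradiction refl x≢y
  ... | inj₁ refl | inj₂ refl | z≡        = z≡
  ... | inj₂ refl | inj₁ refl | inj₁ z≡   = inj₂ z≡
  ... | inj₂ refl | inj₁ refl | inj₂ z≡   = inj₁ z≡

  side-ear : ∀ {v x y} → Side v x → Side v y → x ≢ y → x ~ y → ∀ {z} → v ~ z → z ≡ x ⊎ z ≡ y
  side-ear {v} sx sy x≢y x~y v~z with only sx | only sy
    where
    open Sides (sides-of v)
  ... | inj₁ refl | inj₁ refl = contradiction refl x≢y
  ... | inj₂ refl | inj₂ refl = contradiction refl x≢y
  ... | inj₁ refl | inj₂ refl = Sides.ear (sides-of v) x~y v~z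
  ... | inj₂ refl | inj₁ refl with Sides.ear (sides-of v) (Adj-sym G x~y) v~z
  ...   | inj₁ z≡ = inj₂ z≡
  ...   | inj₂ z≡ = inj₁ z≡

  turn : ∀ {u v} → Side v u → ∃ λ w → Side v w × u ≢ w
  turn {u} {v} _ with u Fin.≟ Sides.left (sides-of v)
  ... | yes refl = _ , Sides.side-right (sides-of v) , Sides.left≢right (sides-of v)
  ... | no u≢l   = _ , Sides.side-left (sides-of v) , u≢l

  -- Boundary cycles.

  SideClosed : (Fin n → Set) → Set
  SideClosed X = ∀ {u v} → X u → Side u v → X v

  -- An endless walk along the boundary together with the time `len` of its first return. Indexing
  -- by all of ℕ spares modular arithmetic.
  record Cycle : Set where
    field
      len    : ℕ
      at     : ℕ → Fin n
      len≥3  : 3 ≤ len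
      at-side : ∀ i → Side (at i) (at (suc i))
      at-turn : ∀ i → at i ≢ at (suc (suc i))
      at-len  : at len ≡ at 0
      at-inj  : InjectiveBelow len at

    Covers : Fin n → Set
    Covers = CoversBelow len at

    covers-start : Covers (at 0)
    covers-start = 0 , <-≤-trans (s≤s z≤n) len≥3 , refl

    closing-≢ : ∀ {l} → suc l ≡ len → at 1 ≢ at l
    closing-≢ l≡len eq with at-inj (<-≤-trans (s≤s (s≤s z≤n)) len≥3) (≤-reflexive l≡len) eq
    ... | refl = contradiction (≡-sym l≡len) (>⇒≢ len≥3)

    closing-side : ∀ {l} → suc l ≡ len → Side (at 0) (at l)
    closing-side {l} l≡len =
      subst (λ x → Side x (at l)) (trans (cong at l≡len) at-len) (side-sym (at-side l))

    -- A vertex has just two boundary neighbours, and its predecessor and successor on the cycle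
    -- account for both. At position 0 the predecessor is found at `len - 1`.
    covers-closed : SideClosed Covers
    covers-closed (suc i , i<len , refl) s
      with side-third (side-sym (at-side i)) (at-side (suc i)) (at-turn i) s
    ... | inj₁ refl = i , <-trans (n<1+n i) i<len , refl
    ... | inj₂ refl with m≤n⇒m<n∨m≡n i<len
    ...   | inj₁ 2+i<len = suc (suc i) , 2+i<len , refl
    ...   | inj₂ 2+i≡len =
      subst Covers (trans (≡-sym at-len) (cong at (≡-sym 2+i≡len))) covers-start
    covers-closed (zero , 0<len , refl) s = first (suc-pred len ⦃ >-nonZero 0<len ⦄)
      where
      first : ∀ {l} → suc l ≡ len → Covers _
      first {l} eq with side-third (at-side 0) (closing-side eq) (closing-≢ eq) s
      ... | inj₁ refl = 1 , <-≤-trans (s≤s (s≤s z≤n)) len≥3 , refl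
      ... | inj₂ refl = l , ≤-reflexive eq , refl

    -- Membership is carried forward from position `i` to `len`, which is the start again, and from
    -- there to any `j`.
    spread : ∀ {X} → SideClosed X → ∀ {x} → Covers x → X x → ∀ j → X (at j)
    spread {X} closed (i , i<len , refl) Xi j =
      subst (X ∘ at) (+-identityʳ j) (from 0 X₀ j)
      where
      from : ∀ i → X (at i) → ∀ j → X (at (j + i))
      from i Xi zero    = Xi
      from i Xi (suc j) = closed (from i Xi j) (at-side (j + i))
      X₀ : X (at 0)
      X₀ = subst X at-len (subst (X ∘ at) (m∸n+n≡m (<⇒≤ i<len)) (from i Xi (len ∸ i)))

    -- On a boundary triangle the two boundary neighbours of each vertex are adjacent, so by
    -- `side-ear` each vertex has degree 2. The triangle is then a whole component, and `x` would
    -- lie on it.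
    len≥4 : Connected G → ∀ {x} → ¬ Covers x → 4 ≤ len
    len≥4 conn {x} ¬cov with m≤n⇒m<n∨m≡n len≥3
    ... | inj₁ 4≤len = 4≤len
    ... | inj₂ 3≡len = contradiction (Closed-walk closed (conn (at 0) x) covers-start) ¬cov
      where
      s₂₀ : Side (at 2) (at 0)
      s₂₀ = subst (Side (at 2)) (trans (cong at 3≡len) at-len) (at-side 2)
      covers : ∀ {i} → i < 3 → Covers (at i)
      covers i<3 = _ , <-≤-trans i<3 len≥3 , refl
      closed : Closed G Covers
      closed (0 , _ , refl) u~v
        with side-ear (at-side 0) (side-sym s₂₀) (side-≢ (at-side 1)) (proj₁ (at-side 1)) u~v
      ... | inj₁ refl = covers (s≤s (s≤s z≤n))
      ... | inj₂ refl = covers (s≤s (s≤s (s≤s z≤n)))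
      closed (1 , _ , refl) u~v
        with side-ear (side-sym (at-side 0)) (at-side 1) (at-turn 0) (proj₁ (side-sym s₂₀)) u~v
      ... | inj₁ refl = covers (s≤s z≤n)
      ... | inj₂ refl = covers (s≤s (s≤s (s≤s z≤n)))
      closed (2 , _ , refl) u~v
        with side-ear (side-sym (at-side 1)) s₂₀ (side-≢ (side-sym (at-side 0)))
                      (proj₁ (side-sym (at-side 0))) u~v
      ... | inj₁ refl = covers (s≤s (s≤s z≤n))
      ... | inj₂ refl = covers (s≤s z≤n)
      closed (suc (suc (suc i)) , i<len , _) _ =
        contradiction (subst (suc (suc (suc i)) <_) (≡-sym 3≡len) i<len) (≤⇒≯ (s≤s (s≤s (s≤s z≤n))))

  open Cycle

  module Trace (p : ℕ → Fin n) (p-side : ∀ i → Side (p i) (p (suc i)))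
               (p-turn : ∀ i → p i ≢ p (suc (suc i))) where

    FirstReturn : ℕ → Set
    FirstReturn m = 3 ≤ m × p m ≡ p 0 × InjectiveBelow m p

    -- The walk cannot run into itself at a later position `j > 0`: the boundary neighbours of `p j`
    -- are `p (j - 1)` and `p (j + 1)`, and `p m` would have to be one of them.
    returns-to-start : ∀ {m j} → InjectiveBelow (suc m) p → j < suc m → p j ≡ p (suc m) → j ≡ 0
    returns-to-start {j = zero} _ _ _ = refl
    returns-to-start {m} {suc j} inj (s≤s j<m) eq
      with side-third (side-sym (p-side j)) (p-side (suc j)) (p-turn j)
                      (subst (λ x → Side x (p m)) (≡-sym eq) (side-sym (p-side m)))
    ... | inj₁ pm≡pj = contradiction (inj (<-trans j<m (n<1+n m)) (n<1+n m) (≡-sym pm≡pj)) (<⇒≢ j<m)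
    ... | inj₂ pm≡p₂ with m≤n⇒m<n∨m≡n j<m
    ...   | inj₂ refl = contradiction eq (side-≢ (p-side (suc j)))
    ...   | inj₁ 2+j≤m with inj (n<1+n m) (s≤s 2+j≤m) pm≡p₂
    ...     | refl = contradiction eq (p-turn (suc j))

    return-len : ∀ {m} → p 0 ≡ p (suc m) → 3 ≤ suc m
    return-len {0} eq = contradiction eq (side-≢ (p-side 0))
    return-len {1} eq = contradiction eq (p-turn 0)
    return-len {suc (suc m)} eq = s≤s (s≤s (s≤s z≤n))

    injectiveBelow-suc : ∀ {m} → InjectiveBelow m p → ¬ CoversBelow m p (p m) → InjectiveBelow (suc m) p
    injectiveBelow-suc inj new (s≤s i≤m) (s≤s j≤m) eq with m≤n⇒m<n∨m≡n i≤m | m≤n⇒m<n∨m≡n j≤m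
    ... | inj₁ i<m  | inj₁ j<m  = inj i<m j<m eq
    ... | inj₂ refl | inj₂ refl = refl
    ... | inj₁ i<m  | inj₂ refl = contradiction (_ , i<m , eq) new
    ... | inj₂ refl | inj₁ j<m  = contradiction (_ , j<m , ≡-sym eq) new

    search : ∀ m → InjectiveBelow (suc m) p ⊎ ∃ FirstReturn
    search zero = inj₁ λ { (s≤s z≤n) (s≤s z≤n) _ → refl }
    search (suc m) with search m
    ... | inj₂ found = inj₂ found
    ... | inj₁ inj with coversBelow? (suc m) p (p (suc m))
    ...   | no new = inj₁ (injectiveBelow-suc inj new)
    ...   | yes (j , j<m , eq) with returns-to-start inj j<m eq
    ...     | refl = inj₂ (suc m , return-len eq , ≡-sym eq , inj)

    -- The walk cannot show `n + 1` different vertices, so `search n` must come upon a return.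
    first-return : ∃ FirstReturn
    first-return with search n
    ... | inj₁ inj   = contradiction (injectiveBelow⇒≤ inj) (<⇒≱ (n<1+n n))
    ... | inj₂ found = found

    cycle : Cycle
    cycle = record
      { len = proj₁ first-return ; at = p ; len≥3 = proj₁ (proj₂ first-return)
      ; at-side = p-side ; at-turn = p-turn
      ; at-len = proj₁ (proj₂ (proj₂ first-return)) ; at-inj = proj₂ (proj₂ (proj₂ first-return)) }

  cycle-along : ∀ {x y} → Side x y → ∃ λ C → at C 0 ≡ x × at C 1 ≡ y
  cycle-along {x} {y} s = Trace.cycle (proj₁ ∘ dart) (proj₂ ∘ proj₂ ∘ dart)
      (λ i → proj₂ (proj₂ (turn (side-sym (proj₂ (proj₂ (dart i))))))) , refl , refl
    where
    dart : ℕ → ∃₂ Side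
    dart zero    = x , y , s
    dart (suc i) = let _ , v , sv = dart i ; w , sw , _ = turn (side-sym sv) in v , w , sw

  cycle-from : ∀ x → ∃ λ C → at C 0 ≡ x
  cycle-from x = let C , eq , _ = cycle-along (Sides.side-left (sides-of x)) in C , eq

  -- Leaving `x` by its other boundary neighbour `z` forces the cycle to come back to `x` through
  -- `y`.
  cycle-between : ∀ {x y} → Side x y → ∃ λ C → at C 0 ≡ x × (∀ {l} → suc l ≡ len C → at C l ≡ y)
  cycle-between {x} {y} s with turn s
  ... | z , sz , y≢z with cycle-along sz
  ...   | C , refl , refl = C , refl , last
    where
    last : ∀ {l} → suc l ≡ len C → at C l ≡ y
    last eq with side-third sz s (y≢z ∘ ≡-sym) (closing-side C eq)
    ... | inj₁ l≡z = contradiction (≡-sym l≡z) (closing-≢ C eq)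
    ... | inj₂ l≡y = l≡y

  -- Merging two boundary cycles.

  Disjoint : Cycle → Cycle → Set
  Disjoint P Q = ∀ {x} → Covers P x → ¬ Covers Q x

  _⊑_ : Cycle → Cycle → Set
  P ⊑ Q = ∀ {x} → Covers P x → Covers Q x

  -- The vertices of `Q` are closed under boundary edges, so a walk along `P` that meets them stays
  -- among them.
  meet⇒⊑ : ∀ {P Q x} → Covers P x → Covers Q x → P ⊑ Q
  meet⇒⊑ {P} {Q} Px Qx (i , _ , refl) = spread P (covers-closed Q) Px Qx i

  uncovered⇒disjoint : ∀ {P Q} → ¬ Covers P (at Q 0) → Disjoint P Q
  uncovered⇒disjoint {P} {Q} ¬P₀ Px Qx = ¬P₀ (meet⇒⊑ {Q} {P} Qx Px (covers-start Q))

  Spanning : Cycle → Cycle → Set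
  Spanning P Q = ∀ x → Covers P x ⊎ Covers Q x

  module Pair (P Q : Cycle) (disj : Disjoint P Q) where

    joint : ℕ → Fin n
    joint = splice (len P) (at P) (at Q)

    joint-P : ∀ {i} → i < len P → joint i ≡ at P i
    joint-P = splice-< {p = at P} {at Q}

    joint-Q : ∀ j → joint (len P + j) ≡ at Q j
    joint-Q = splice-+ {a = len P} {at P} {at Q}

    joint-inj : InjectiveBelow (len P + len Q) joint
    joint-inj = splice-injective (at-inj P) (at-inj Q)
      λ i<a j<b eq → disj (_ , i<a , refl) (_ , j<b , ≡-sym eq)

    joint-P-covers : ∀ {u} → u < len P → Covers P (joint u)
    joint-P-covers u<a = _ , u<a , ≡-sym (joint-P u<a)

    joint-Q-covers : ∀ {u} → u < len P + len Q → u ≮ len P → Covers Q (joint u)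
    joint-Q-covers {u} u<n u≮a =
      u ∸ len P , m≮n⇒m∸n<o u<n u≮a , ≡-sym (splice-≥ {p = at P} {at Q} (≮⇒≥ u≮a))

    joint-covered : ∀ {u} → u < len P + len Q → Covers P (joint u) ⊎ Covers Q (joint u)
    joint-covered {u} u<n = covered (u <? len P)
      where
      covered : Dec (u < len P) → Covers P (joint u) ⊎ Covers Q (joint u)
      covered (yes u<a) = inj₁ (joint-P-covers u<a)
      covered (no u≮a)  = inj₂ (joint-Q-covers u<n u≮a)

    joint-covers : ∀ {x} → Covers P x ⊎ Covers Q x → CoversBelow (len P + len Q) joint x
    joint-covers = [ splice-coversˡ , splice-coversʳ ]′

    total : Spanning P Q → len P + len Q ≡ n
    total span = ≤-antisym (injectiveBelow⇒≤ joint-inj) (covers⇒≤ (λ x → joint-covers (span x)))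

    ham-joint : 3 ≤ n → Spanning P Q →
      (∀ {l} → suc l ≡ len P → at P l ~ at Q 0) → (∀ {l} → suc l ≡ len Q → at Q l ~ at P 0) → Hamiltonian G
    ham-joint 3≤n span P~Q Q~P = 
      hamiltonian {G = G} 3≤n joint (subst (λ m → InjectiveBelow m joint) (total span) joint-inj) next close
      where
      a = len P
      b = len Q
      joint-~ : ∀ {i j x y} → joint i ≡ x → joint j ≡ y → x ~ y → joint i ~ joint j
      joint-~ refl refl x~y = x~y
      joint-0 : joint 0 ≡ at P 0
      joint-0 = joint-P (<-≤-trans (s≤s z≤n) (len≥3 P))
      next : ∀ {i} → suc i < n → joint i ~ joint (suc i)
      next {i} _ with <-cmp (suc i) a
      ... | tri< i<a _ _ = joint-~ (joint-P (<-trans (n<1+n i) i<a)) (joint-P i<a) (proj₁ (at-side P i))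
      ... | tri≈ _ 1+i≡a _ = joint-~ (joint-P (≤-reflexive 1+i≡a))
        (trans (cong joint (trans 1+i≡a (≡-sym (+-identityʳ a)))) (joint-Q 0)) (P~Q 1+i≡a)
      ... | tri> _ _ (s≤s a≤i) with m≤n⇒∃[o]m+o≡n a≤i
      ...   | j , refl = joint-~ (joint-Q j)
        (trans (cong joint (≡-sym (+-suc a j))) (joint-Q (suc j))) (proj₁ (at-side Q j))
      close : ∀ {m} → suc m ≡ n → joint m ~ joint 0
      close {m} eq with a ≤? m
      ... | no a≰m = contradiction (trans eq (≡-sym (total span)))
        (<⇒≢ (≤-<-trans (≰⇒> a≰m) (m<m+n a (<-≤-trans (s≤s z≤n) (len≥3 Q)))))
      ... | yes a≤m with m≤n⇒∃[o]m+o≡n a≤m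
      ...   | j , refl = joint-~ (joint-Q j) joint-0
        (Q~P (+-cancelˡ-≡ a _ _ (trans (+-suc a j) (trans eq (≡-sym (total span))))))

  -- Cut the cycles open at `x x′` and `y y′`: run from `x′` round to `x`, cross to `y`, run round
  -- to `y′`, and return to `x′`. The cycles `P′` and `Q′` retrace `P` and `Q` with these ends.
  merge : ∀ {P Q} → 3 ≤ n → Disjoint P Q → Spanning P Q → ∀ {x x′ y y′} → Covers P x → Covers Q y →
          Side x x′ → Side y y′ → x ~ y → x′ ~ y′ → Hamiltonian G
  merge {P} {Q} 3≤n disj span Px Qy sx sy x~y x′~y′
    with cycle-between (side-sym sx) | cycle-between sy
  ... | P′ , refl , P-last | Q′ , refl , Q-last = Pair.ham-joint P′ Q′
      (λ P′z Q′z → disj (P′⊑P P′z) (Q′⊑Q Q′z)) 3≤n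
      (λ z → Sum.map (meet⇒⊑ {P} {P′} Px′ (covers-start P′)) (meet⇒⊑ {Q} {Q′} Qy (covers-start Q′)) (span z))
      (λ eq → subst (_~ at Q′ 0) (≡-sym (P-last eq)) x~y)
      (λ eq → Adj-sym G (subst (at P′ 0 ~_) (≡-sym (Q-last eq)) x′~y′))
    where
    Px′ = covers-closed P Px sx
    P′⊑P : P′ ⊑ P
    P′⊑P = meet⇒⊑ {P′} {P} (covers-start P′) Px′
    Q′⊑Q : Q′ ⊑ Q
    Q′⊑Q = meet⇒⊑ {Q′} {Q} (covers-start Q′) Qy

  ham-single : ∀ P → 3 ≤ n → (∀ x → Covers P x) → Hamiltonian G
  ham-single P 3≤n cov = hamiltonian {G = G} 3≤n (at P)
    (subst (λ m → InjectiveBelow m (at P)) len≡n (at-inj P))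
    (λ {i} _ → proj₁ (at-side P i)) (λ eq → Adj-sym G (proj₁ (closing-side P (trans eq (≡-sym len≡n)))))
    where
    len≡n : len P ≡ n
    len≡n = ≤-antisym (injectiveBelow⇒≤ (at-inj P)) (covers⇒≤ cov)

-- Labelling the vertices along two boundary cycles.

module _ {V W : Set} {_~_ : V → V → Set} {_≈_ : W → W → Set} {f : V → W}
         (f-~ : ∀ {u v} → u ~ v → f u ≈ f v)
         (f-inj : ∀ {v x y} → v ~ x → v ~ y → f x ≡ f y → x ≡ y) where

  linkWalk-~ : ∀ {v s x y} → LinkWalk _~_ v s x y → v ~ s × v ~ x × v ~ y
  linkWalk-~ (depart v~s v~x _)     = v~s , v~s , v~x
  linkWalk-~ (extend walk v~z _ _) = let v~s , _ , v~y = linkWalk-~ walk in v~s , v~y , v~z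

  linkWalk-map : ∀ {v s x y} → LinkWalk _~_ v s x y → LinkWalk _≈_ (f v) (f s) (f x) (f y)
  linkWalk-map (depart v~s v~x s~x)      = depart (f-~ v~s) (f-~ v~x) (f-~ s~x)
  linkWalk-map (extend walk v~z y~z z≢x) = extend (linkWalk-map walk) (f-~ v~z) (f-~ y~z)
    λ eq → z≢x (f-inj v~z (proj₁ (proj₂ (linkWalk-~ walk))) eq)

if-≡ᵇ : ∀ (X : ℕ → Set) m n {x y} → (m ≡ n → X x) → (m ≢ n → X y) → X (if m ≡ᵇ n then x else y)
if-≡ᵇ X m n f g with m ≡ᵇ n | ≡ᵇ⇒≡ m n | ≡⇒≡ᵇ m n
... | true  | m≡n | _   = f (m≡n _)
... | false | _   | m≢n = g m≢n

module Labels (a b : ℕ) (a≥3 : 3 ≤ a) (b≥3 : 3 ≤ b) where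

  -- The graph of `nextLabel` as a relation; read backwards, it also describes `prevLabel`.
  data Next (u : ℕ) : ℕ → Set where
    wrapˡ : suc u ≡ a → Next u 0
    wrapʳ : suc u ≡ a + b → Next u a
    step  : suc u ≢ a → suc u ≢ a + b → Next u (suc u)

  0<a : 0 < a
  0<a = <-≤-trans (s≤s z≤n) a≥3

  0<b : 0 < b
  0<b = <-≤-trans (s≤s z≤n) b≥3

  0<a+b : 0 < a + b
  0<a+b = <-≤-trans 0<a (m≤m+n a b)

  next : ∀ u → Next u (nextLabel a b u)
  next u = if-≡ᵇ (Next u) (suc u) a wrapˡ λ u≢a → if-≡ᵇ (Next u) (suc u) (a + b) wrapʳ (step u≢a)

  prev : ∀ {u} → u < a + b → Next (prevLabel a b u) u × prevLabel a b u < a + b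
  prev {zero}  _   = wrapˡ (suc-pred a ⦃ >-nonZero 0<a ⦄)
                   , <-≤-trans (≤-reflexive (suc-pred a ⦃ >-nonZero 0<a ⦄)) (m≤m+n a b)
  prev {suc u} u<n = if-≡ᵇ (λ w → Next w (suc u) × w < a + b) (suc u) a
    (λ u≡a → subst (Next _) (≡-sym u≡a) (wrapʳ 1+pred) , ≤-reflexive 1+pred)
    (λ u≢a → step u≢a (<⇒≢ u<n) , <-trans (n<1+n u) u<n)
    where
    1+pred : suc (a + b ∸ 1) ≡ a + b
    1+pred = suc-pred (a + b) ⦃ >-nonZero 0<a+b ⦄

  -- Coming back after two steps takes a cycle of length 1 or 2, while `a` and `b` are at least 3.
  next-turn : ∀ {u v w} → Next u v → Next v w → u ≢ w
  next-turn {u} = go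
    where
    below-a : ∀ k → k < 3 → k ≢ a
    below-a k k<3 = <⇒≢ (<-≤-trans k<3 a≥3)
    below-b : ∀ k → k < 3 → k + a ≢ a + b
    below-b k k<3 eq = <⇒≢ (+-monoʳ-< a (<-≤-trans k<3 b≥3)) (trans (+-comm a k) eq)
    2<3 : 2 < 3
    2<3 = n<1+n 2
    go : ∀ {v w} → Next u v → Next v w → u ≢ w
    go (wrapˡ eq) (wrapˡ eq′) _    = below-a 1 (s≤s (s≤s z≤n)) eq′
    go (wrapˡ eq) (wrapʳ eq′) _    = <⇒≢ (<-≤-trans (<-≤-trans (s≤s (s≤s z≤n)) a≥3) (m≤m+n a b)) eq′
    go (wrapˡ eq) (step _ _)  refl = below-a 2 2<3 eq
    go (wrapʳ eq) (wrapˡ eq′) _    = contradiction eq′ 1+n≢n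
    go (wrapʳ eq) (wrapʳ eq′) _    = below-b 1 (s≤s (s≤s z≤n)) eq′
    go (wrapʳ eq) (step _ _)  refl = below-b 2 2<3 eq
    go (step _ _) (wrapˡ eq)  refl = below-a 2 2<3 eq
    go (step _ _) (wrapʳ eq)  refl = below-b 2 2<3 eq
    go (step _ _) (step _ _)  ()

<-or-+ : ∀ m n → n < m ⊎ ∃ λ j → m + j ≡ n
<-or-+ m n with n <? m
... | yes n<m = inj₁ n<m
... | no n≮m  = inj₂ (m≤n⇒∃[o]m+o≡n (≮⇒≥ n≮m))

xor-<ᵇ : ∀ u v a → T ((u <ᵇ a) xor (v <ᵇ a)) → (u < a × v ≮ a) ⊎ (u ≮ a × v < a)
xor-<ᵇ u v a t with u <ᵇ a | <ᵇ⇒< u a | <⇒<ᵇ {u} {a} | v <ᵇ a | <ᵇ⇒< v a | <⇒<ᵇ {v} {a}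
... | true  | u<a | _   | false | _   | v≮a = inj₁ (u<a _ , v≮a)
... | false | _   | u≮a | true  | v<a | _   = inj₂ (u≮a , v<a _)

module _ {n : ℕ} (G : Graph n) (fans : ∀ v → Fan G v)
         (apex : ∀ {u v} → Adj G u v → ∃ λ w → Adj G u w × Adj G v w) where

  open Boundary G fans apex hiding (_~_)
  open Cycle

  module Model (P Q : Cycle) (disj : Disjoint P Q) (span : Spanning P Q) where

    open Pair P Q disj

    a b : ℕ
    a = len P
    b = len Q

    open Labels a b (len≥3 P) (len≥3 Q)

    next-side : ∀ {u v} → u < a + b → Next u v → v < a + b × Side (joint u) (joint v)
    next-side {u} u<n (wrapˡ 1+u≡a) = 0<a+b
      , subst₂ Side (≡-sym (joint-P (≤-reflexive 1+u≡a)))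
          (trans (trans (cong (at P) 1+u≡a) (at-len P)) (≡-sym (joint-P 0<a))) (at-side P u)
    next-side {u} u<n (wrapʳ 1+u≡n) with <-or-+ a u
    ... | inj₁ u<a = contradiction 1+u≡n (<⇒≢ (≤-<-trans u<a (m<m+n a 0<b)))
    ... | inj₂ (j , refl) = m<m+n a 0<b
      , subst₂ Side (≡-sym (joint-Q j))
          (trans (trans (cong (at Q) 1+j≡b) (at-len Q))
                 (trans (≡-sym (joint-Q 0)) (cong joint (+-identityʳ a)))) (at-side Q j)
      where
      1+j≡b : suc j ≡ b
      1+j≡b = +-cancelˡ-≡ a _ _ (trans (+-suc a j) 1+u≡n)
    next-side {u} u<n (step 1+u≢a 1+u≢n) with <-or-+ a u
    ... | inj₁ u<a = ≤∧≢⇒< u<n 1+u≢n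
      , subst₂ Side (≡-sym (joint-P u<a)) (≡-sym (joint-P (≤∧≢⇒< u<a 1+u≢a))) (at-side P u)
    ... | inj₂ (j , refl) = ≤∧≢⇒< u<n 1+u≢n
      , subst₂ Side (≡-sym (joint-Q j)) 
          (trans (≡-sym (joint-Q (suc j))) (cong joint (+-suc a j))) (at-side Q j)

    sides-Side : ∀ {u v} → u < a + b → v ∈ sides a b u → v < a + b × Side (joint u) (joint v)
    sides-Side {u} u<n (here refl) = next-side u<n (next u)
    sides-Side {u} u<n (there (here refl)) with prev u<n
    ... | next-u , p<n = p<n , side-sym (proj₂ (next-side p<n next-u))

    -- The next and the previous label already give two distinct boundary neighbours of `joint u`,
    -- and there is no third.
    Side-sides : ∀ {u v} → u < a + b → v < a + b → Side (joint u) (joint v) → v ∈ sides a b u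
    Side-sides {u} u<n v<n s with sides-Side u<n (here refl) | sides-Side u<n (there (here refl))
    ... | nx<n , nx | pv<n , pv with side-third nx pv nx≢pv s
      where
      nx≢pv : joint (nextLabel a b u) ≢ joint (prevLabel a b u)
      nx≢pv eq = next-turn (proj₁ (prev u<n)) (next u) (≡-sym (joint-inj nx<n pv<n eq))
    ...   | inj₁ v≡nx = here (joint-inj v<n nx<n v≡nx)
    ...   | inj₂ v≡pv = there (here (joint-inj v<n pv<n v≡pv))

    -- The bounds are part of the relation because `joint` repeats vertices from `a + b` on.
    _~_ : ℕ → ℕ → Set
    u ~ v = u < a + b × v < a + b × Adj G (joint u) (joint v)

    module _ (3≤n : 3 ≤ n) (¬ham : ¬ Hamiltonian G) (P~Q : Adj G (at P 0) (at Q 0)) where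

      unmergeable : ∀ {u v u′ v′} → T ((u <ᵇ a) xor (v <ᵇ a)) → u ~ v →
                    u′ ∈ sides a b u → v′ ∈ sides a b v → u′ ~ v′ → ⊥
      unmergeable {u} {v} opposite (u<n , v<n , u~v) u′∈ v′∈ (_ , _ , u′~v′)
        with xor-<ᵇ u v a opposite
      ... | inj₁ (u<a , v≮a) = ¬ham (merge {P} {Q} 3≤n disj span
        (joint-P-covers u<a) (joint-Q-covers v<n v≮a)
        (proj₂ (sides-Side u<n u′∈)) (proj₂ (sides-Side v<n v′∈)) u~v u′~v′)
      ... | inj₂ (u≮a , v<a) = ¬ham (merge {P} {Q} 3≤n disj span
        (joint-P-covers v<a) (joint-Q-covers u<n u≮a)
        (proj₂ (sides-Side v<n v′∈)) (proj₂ (sides-Side u<n u′∈)) (Adj-sym G u~v) (Adj-sym G u′~v′))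

      label : ∀ x → ∃ λ w → w < a + b × joint w ≡ x
      label x = joint-covers (span x)

      model : TwoCycleModel a b _~_
      model = record
        { ~-sym = λ { (u<n , v<n , u~v) → v<n , u<n , Adj-sym G u~v }
        ; ~-irrefl = λ { (_ , _ , u~u) → Adj-irrefl G u~u }
        ; ~-bound = λ { (_ , v<n , _) → v<n }
        ; side-~ = λ u<n v∈ → let v<n , s = sides-Side u<n v∈ in u<n , v<n , proj₁ s
        ; start-~ = 0<a+b , m<m+n a 0<b
          , subst₂ (Adj G) (≡-sym (joint-P 0<a)) (trans (≡-sym (joint-Q 0)) (cong joint (+-identityʳ a))) P~Q
        ; apex = λ { (u<n , v<n , u~v) →
            let x , u~x , v~x = apex u~v
                w , w<n , w≡x = label x
            in w , (u<n , w<n , subst (Adj G _) (≡-sym w≡x) u~x)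
                 , (v<n , w<n , subst (Adj G _) (≡-sym w≡x) v~x) }
        ; apex-other = λ { (u<n , v<n , u~v) v∉ w →
            let x , w≢x , u~x , v~x = apex-other u~v (v∉ ∘ Side-sides u<n v<n) (joint w)
                w′ , w′<n , w′≡x = label x
            in w′ , (λ w≡w′ → w≢x (trans (cong joint w≡w′) w′≡x))
              , (u<n , w′<n , subst (Adj G _) (≡-sym w′≡x) u~x)
              , (v<n , w′<n , subst (Adj G _) (≡-sym w′≡x) v~x) }
        ; side-apex = λ { _ v∈ (u<n , w<n , u~w) (_ , _ , v~w) (_ , w′<n , u~w′) (_ , _ , v~w′) →
            joint-inj w<n w′<n (proj₂ (proj₂ (sides-Side u<n v∈)) u~w v~w u~w′ v~w′) }
        ; two-apices = λ { (_ , _ , u~v) (_ , x<n , u~x) (_ , _ , v~x) (_ , y<n , u~y) (_ , _ , v~y)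
                           (_ , z<n , u~z) (_ , _ , v~z) x≢y x≢z y≢z →
            two-apices u~v u~x v~x u~y v~y u~z v~z
              (x≢y ∘ joint-inj x<n y<n) (x≢z ∘ joint-inj x<n z<n) (y≢z ∘ joint-inj y<n z<n) }
        ; link-acyclic = λ walk y≡s → link-acyclic (linkWalk-map {f = joint} (proj₂ ∘ proj₂)
            (λ { (_ , x<n , _) (_ , y<n , _) → joint-inj x<n y<n }) walk) (cong joint y≡s)
        ; unmergeable = unmergeable
        }

-- The lower bound.

apex-or-sole : ∀ {n} {G : Graph n} {u v} → Fan G u → Adj G u v →
               (∃ λ w → Adj G u w × Adj G v w) ⊎ (∀ {x} → Adj G u x → x ≡ v)
apex-or-sole {G = G} {u} {v} F u~v with Fan.nbr-at F u~v
-- The predecessor of `v` on the path around `u` serves as apex. At position 0 the successor does,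
-- unless `v` is the whole path.
... | suc i , at-v =
  let w , at-w = at-total (<-trans (n<1+n i) (at-bound at-v))
  in inj₁ (w , at-nbr at-w , at-adj at-v at-w (inj₂ refl))
  where
  open Fan F
... | zero , at-v with 1 <? Fan.size F
...   | yes 1<s = let w , at-w = at-total 1<s in inj₁ (w , at-nbr at-w , at-adj at-v at-w (inj₁ refl))
  where
  open Fan F
...   | no 1≮s = inj₂ sole
  where
  open Fan F
  sole : ∀ {x} → Adj G u x → x ≡ v
  sole u~x with nbr-at u~x
  ... | zero  , at-x = at-functional at-x at-v
  ... | suc i , at-x = contradiction (≤-<-trans (s≤s z≤n) (at-bound at-x)) 1≮s

-- If `u` and `v` had no neighbours but each other, they would form a component, and a connected
-- graph would have at most two vertices.
apex-exists : ∀ {n} {G : Graph n} → 3 ≤ n → Connected G → (∀ v → Fan G v) →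
              ∀ {u v} → Adj G u v → ∃ λ w → Adj G u w × Adj G v w
apex-exists {n} {G} 3≤n conn fans {u} {v} u~v
  with apex-or-sole (fans u) u~v | apex-or-sole (fans v) (Adj-sym G u~v)
... | inj₁ found | _                   = found
... | inj₂ _     | inj₁ (w , v~w , u~w) = w , u~w , v~w
... | inj₂ only-v | inj₂ only-u =
  contradiction (covers⇒≤ {m = 2} {ends} (λ x → Closed-walk closed (conn u x) (0 , s≤s z≤n , refl))) (<⇒≱ 3≤n)
  where
  ends : ℕ → Fin n
  ends zero    = u
  ends (suc _) = v
  closed : Closed G (CoversBelow 2 ends)
  closed (zero , _ , refl)  u~x = 1 , s≤s (s≤s z≤n) , ≡-sym (only-v u~x)
  closed (suc _ , _ , refl) v~x = 0 , s≤s z≤n , ≡-sym (only-u v~x)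

-- An inductive wrapper, so that the search is not unfolded for symbolic a and b.
data Refuted (a b : ℕ) : Set where
  refuted : ∀ k → refute a b k (start a b) ≡ true → Refuted a b

refuted⇒no-model : ∀ {a b _~_} → Refuted a b → ¬ TwoCycleModel a b _~_
refuted⇒no-model (refuted k eq) M = refute-sound k start-valid (subst T (≡-sym eq) _)
  where
  open Soundness M

-- The arguments are the excesses of the lengths over 4, so a total of at most 11 leaves ten pairs.
-- Each `refl` runs the search, for which depth 30 is enough in all ten cases.
refutable : ∀ a b → a + b ≤ 3 → Refuted (4 + a) (4 + b)
refutable 0 0 _ = refuted 30 refl
refutable 0 1 _ = refuted 30 refl
refutable 0 2 _ = refuted 30 refl
refutable 0 3 _ = refuted 30 refl
refutable 1 0 _ = refuted 30 refl
refutable 1 1 _ = refuted 30 refl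
refutable 1 2 _ = refuted 30 refl
refutable 2 0 _ = refuted 30 refl
refutable 2 1 _ = refuted 30 refl
refutable 3 0 _ = refuted 30 refl
refutable 0 (suc (suc (suc (suc _)))) (s≤s (s≤s (s≤s ())))
refutable 1 (suc (suc (suc _)))       (s≤s (s≤s (s≤s ())))
refutable 2 (suc (suc _))             (s≤s (s≤s (s≤s ())))
refutable 3 (suc _)                   (s≤s (s≤s (s≤s ())))
refutable (suc (suc (suc (suc _)))) _ (s≤s (s≤s (s≤s ())))

no-two-cycles : ∀ {a b _~_} → 4 ≤ a → 4 ≤ b → a + b ≤ 11 → ¬ TwoCycleModel a b _~_
no-two-cycles 4≤a 4≤b a+b≤11 with m≤n⇒∃[o]m+o≡n 4≤a | m≤n⇒∃[o]m+o≡n 4≤b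
... | a , refl | b , refl = refuted⇒no-model (refutable a b (+-cancelˡ-≤ 8 _ _
  (subst (_≤ 11) (cong (4 +_) (trans (+-comm a (4 + b)) (cong (4 +_) (+-comm b a)))) a+b≤11)))

module _ {n : ℕ} (G : Graph n) (fans : ∀ v → Fan G v)
         (apex : ∀ {u v} → Adj G u v → ∃ λ w → Adj G u w × Adj G v w)
         (3≤n : 3 ≤ n) (conn : Connected G) (¬ham : ¬ Hamiltonian G) where

  open Boundary G fans apex
  open Cycle

  spans? : ∀ P Q x → Dec (Covers P x ⊎ Covers Q x)
  spans? P Q x = coversBelow? (len P) (at P) x ⊎-dec coversBelow? (len Q) (at Q) x

  -- If `P` and `Q` cover everything, the order is the sum of their lengths, which the search shows
  -- not to be below 12. Otherwise an uncovered vertex lies on a third cycle, and three disjoint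
  -- cycles have at least 4 vertices each.
  order≥12-disjoint : ∀ P Q → Disjoint P Q → at P 0 ~ at Q 0 → 12 ≤ n
  order≥12-disjoint P Q disj P~Q with Fin.all? (spans? P Q)
  ... | yes span with 12 ≤? n
  ...   | yes 12≤n = 12≤n
  ...   | no 12≰n = contradiction (Model.model G fans apex P Q disj span 3≤n ¬ham P~Q)
      (no-two-cycles (len≥4 P conn (λ Px → disj Px (covers-start Q))) (len≥4 Q conn (disj (covers-start P)))
        (subst (_≤ 11) (≡-sym (Pair.total P Q disj span)) (≤-pred (≰⇒> 12≰n))))
  order≥12-disjoint P Q disj P~Q | no ¬span
    with Fin.¬∀⟶∃¬ n _ (spans? P Q) ¬span
  ... | z , z∉ with cycle-from z
  ...   | R , refl = ≤-trans (+-mono-≤ (+-mono-≤ P≥4 Q≥4) R≥4) (injectiveBelow⇒≤ three-inj)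
    where
    P≥4 = len≥4 P conn (λ Px → z∉ (inj₁ Px))
    Q≥4 = len≥4 Q conn (λ Qx → z∉ (inj₂ Qx))
    disjPR = uncovered⇒disjoint {P} {R} (λ Px → z∉ (inj₁ Px))
    disjQR = uncovered⇒disjoint {Q} {R} (λ Qx → z∉ (inj₂ Qx))
    R≥4 = len≥4 R conn (disjPR (covers-start P))
    three : ℕ → Fin n
    three = splice (len P + len Q) (Pair.joint P Q disj) (at R)
    three-inj : InjectiveBelow (len P + len Q + len R) three
    three-inj = splice-injective (Pair.joint-inj P Q disj) (at-inj R)
      λ i<ab j<c eq → [ (λ Pi → disjPR Pi (_ , j<c , ≡-sym eq)) , (λ Qi → disjQR Qi (_ , j<c , ≡-sym eq)) ]′
        (Pair.joint-covered P Q disj i<ab)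

  -- Restarting the cycles at the ends of the edge puts it between `at P 0` and `at Q 0`, as the
  -- search requires.
  order≥12-crossing : ∀ C {u w} → Covers C u → ¬ Covers C w → u ~ w → 12 ≤ n
  order≥12-crossing C {u} {w} Cu ¬Cw u~w with cycle-from u | cycle-from w
  ... | P , refl | Q , refl = order≥12-disjoint P Q
    (uncovered⇒disjoint {P} {Q} (λ Pw → ¬Cw (meet⇒⊑ {P} {C} (covers-start P) Cu Pw))) u~w

  -- A boundary cycle through all vertices would be a Hamilton cycle, so some vertex is missed, and
  -- by connectedness an edge leaves the cycle.
  order≥12-cycle : Cycle → 12 ≤ n
  order≥12-cycle C =
    let covers? = coversBelow? (len C) (at C)
        x , ¬Cx = Fin.¬∀⟶∃¬ n (Covers C) covers? λ cov → ¬ham (ham-single C 3≤n cov)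
        _ , _ , Cu , ¬Cw , u~w = leaves-set covers? (conn (at C 0) x) (covers-start C) ¬Cx
    in order≥12-crossing C Cu ¬Cw u~w

order≥12 : ∀ {n} (G : Graph n) → 3 ≤ n → Connected G → LocallyLinear G → ¬ Hamiltonian G → 12 ≤ n
order≥12 G 3≤n conn ll ¬ham = order≥12-cycle G fans apex 3≤n conn ¬ham
  (proj₁ (Boundary.cycle-from G fans apex (fromℕ< (<-≤-trans (s≤s z≤n) 3≤n))))
  where
  fans : ∀ v → Fan G v
  fans v = fan (ll v)
  apex : ∀ {u v} → Adj G u v → ∃ λ w → Adj G u w × Adj G v w
  apex = apex-exists 3≤n conn fans

-- The extremal graph.

-- The antiprism joins the squares 0 1 2 3 and 4 6 8 10; the ears are 5, 7, 9 and 11.  Each list is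
-- the path induced by the neighbourhood.
rotation : Fin 12 → List (Fin 12)
rotation v = Vec.lookup table v
  where
  table : Vec (List (Fin 12)) 12
  table =
      (# 3 ∷ # 4 ∷ # 6 ∷ # 1 ∷ [])
    ∷ (# 0 ∷ # 6 ∷ # 8 ∷ # 2 ∷ [])
    ∷ (# 1 ∷ # 8 ∷ # 10 ∷ # 3 ∷ [])
    ∷ (# 2 ∷ # 10 ∷ # 4 ∷ # 0 ∷ [])
    ∷ (# 11 ∷ # 10 ∷ # 3 ∷ # 0 ∷ # 6 ∷ # 5 ∷ [])
    ∷ (# 4 ∷ # 6 ∷ [])
    ∷ (# 5 ∷ # 4 ∷ # 0 ∷ # 1 ∷ # 8 ∷ # 7 ∷ [])
    ∷ (# 6 ∷ # 8 ∷ [])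
    ∷ (# 7 ∷ # 6 ∷ # 1 ∷ # 2 ∷ # 10 ∷ # 9 ∷ [])
    ∷ (# 8 ∷ # 10 ∷ [])
    ∷ (# 9 ∷ # 8 ∷ # 2 ∷ # 3 ∷ # 4 ∷ # 11 ∷ [])
    ∷ (# 10 ∷ # 4 ∷ [])
    ∷ []

_∈ᶠ_ : Fin 12 → List (Fin 12) → Bool
x ∈ᶠ xs = any (λ y → toℕ x ≡ᵇ toℕ y) xs

earedAntiprism : Graph 12
earedAntiprism = record
  { adj    = λ u v → v ∈ᶠ rotation u
  ; sym    = toWitness {a? = Fin.all? λ u → Fin.all? λ v → (v ∈ᶠ rotation u) Bool.≟ (u ∈ᶠ rotation v)} _
  ; irrefl = toWitness {a? = Fin.all? λ v → (v ∈ᶠ rotation v) Bool.≟ false} _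
  }

consecutive? : ∀ i j → Dec (Consecutive i j)
consecutive? i j = (suc i ≟ j) ⊎-dec (suc j ≟ i)

earedAntiprism-locallyLinear : LocallyLinear earedAntiprism
earedAntiprism-locallyLinear v = length (rotation v)
  , toWitness {a? = Fin.all? λ v → 1 ≤? length (rotation v)} _ v
  , List.lookup (rotation v)
  , (λ {i} {j} → inj v i j)
  , (λ u → mk⇔ (nbr⁺ v u) (nbr⁻ v u))
  , (λ i j → mk⇔ (path⁺ v i j) (path⁻ v i j))
  where
  G = earedAntiprism
  inj : ∀ v i j → List.lookup (rotation v) i ≡ List.lookup (rotation v) j → i ≡ j
  inj = toWitness {a? = Fin.all? λ v → Fin.all? λ i → Fin.all? λ j → (_ Fin.≟ _) →-dec (i Fin.≟ j)} _
  nbr⁺ : ∀ v u → Adj G v u → ∃ λ i → List.lookup (rotation v) i ≡ u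
  nbr⁺ = toWitness {a? = Fin.all? λ v → Fin.all? λ u → T? _ →-dec Fin.any? λ i → _ Fin.≟ u} _
  nbr⁻ : ∀ v u → (∃ λ i → List.lookup (rotation v) i ≡ u) → Adj G v u
  nbr⁻ = toWitness {a? = Fin.all? λ v → Fin.all? λ u → (Fin.any? λ i → _ Fin.≟ u) →-dec T? _} _
  path⁺ : ∀ v i j → Adj G (List.lookup (rotation v) i) (List.lookup (rotation v) j) →
          Consecutive (toℕ i) (toℕ j)
  path⁺ = toWitness {a? = Fin.all? λ v → Fin.all? λ i → Fin.all? λ j → T? _ →-dec consecutive? _ _} _
  path⁻ : ∀ v i j → Consecutive (toℕ i) (toℕ j) →
          Adj G (List.lookup (rotation v) i) (List.lookup (rotation v) j)
  path⁻ = toWitness {a? = Fin.all? λ v → Fin.all? λ i → Fin.all? λ j → consecutive? _ _ →-dec T? _} _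

-- Exhaustive search over paths: no continuation from `v` by `k` further unvisited vertices ends at
-- a neighbour of `first`.
dead : Fin 12 → ℕ → List (Fin 12) → Fin 12 → Bool
dead first zero    visited v = not (first ∈ᶠ rotation v)
dead first (suc k) visited v = all (λ w → (w ∈ᶠ visited) ∨ dead first k (w ∷ visited) w) (rotation v)

all-allFin : ∀ {n} (p : Fin n → Bool) → all p (allFin n) ≡ true → ∀ v → T (p v)
all-allFin p eq v = lookup (all⁺ p (allFin _) (subst T (≡-sym eq) _)) (∈-allFin v)

-- Trying all twelve starting vertices avoids rotating a Hamilton cycle; 11 further vertices
-- complete it.
all-dead : ∀ v → T (dead v 11 (v ∷ []) v)
all-dead = all-allFin (λ v → dead v 11 (v ∷ []) v) refl

∈ᶠ⇒∈ : ∀ {x} xs → T (x ∈ᶠ xs) → x ∈ xs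
∈ᶠ⇒∈ xs t = Any.map (Fin.toℕ-injective ∘ ≡ᵇ⇒≡ _ _) (any⁻ _ xs t)

earedAntiprism-nonhamiltonian : ¬ Hamiltonian earedAntiprism
earedAntiprism-nonhamiltonian (_ , c , c-inj , next , close) =
  stuck 11 (c zero ∷ []) zero refl (λ { (here refl) → zero , z≤n , refl })
    (all-dead (c zero))
  where
  -- Follows `c` through the search. Visited vertices are values of `c` at positions up to `i`, so
  -- injectivity makes the next one new.
  stuck : ∀ k visited (i : Fin 12) → toℕ i + k ≡ 11 →
          (∀ {x} → x ∈ visited → ∃ λ j → toℕ j ≤ toℕ i × c j ≡ x) → T (dead (c zero) k visited (c i)) → ⊥
  stuck zero visited i i≡11 _ t =
    -- With no steps left, `i` is the last position, and the closing edge of `c` leads to `c zero`.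
    T-not⁻ t (close zero i refl (cong suc (trans (≡-sym (+-identityʳ _)) i≡11)))
  stuck (suc k) visited i i+k≡11 seen t = step-on (T-∨⁻ {c i′ ∈ᶠ visited}
    (lookup (all⁺ (λ w → (w ∈ᶠ visited) ∨ dead (c zero) k (w ∷ visited) w) (rotation (c i)) t)
            (∈ᶠ⇒∈ (rotation (c i)) (next i i′ (≡-sym i′≡1+i)))))
    where
    1+i+k≡11 : suc (toℕ i) + k ≡ 11
    1+i+k≡11 = trans (≡-sym (+-suc (toℕ i) k)) i+k≡11
    i<11 : suc (toℕ i) < 12
    i<11 = s≤s (subst (suc (toℕ i) ≤_) 1+i+k≡11 (m≤m+n _ k))
    i′ : Fin 12
    i′ = fromℕ< i<11
    i′≡1+i : toℕ i′ ≡ suc (toℕ i)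
    i′≡1+i = Fin.toℕ-fromℕ< i<11
    i≤i′ : toℕ i ≤ toℕ i′
    i≤i′ = subst (toℕ i ≤_) (≡-sym i′≡1+i) (n≤1+n _)
    seen′ : ∀ {x} → x ∈ c i′ ∷ visited → ∃ λ j → toℕ j ≤ toℕ i′ × c j ≡ x
    seen′ (here refl) = i′ , ≤-refl , refl
    seen′ (there x∈)  = let j , j≤i , cj≡x = seen x∈ in j , ≤-trans j≤i i≤i′ , cj≡x
    step-on : T (c i′ ∈ᶠ visited) ⊎ T (dead (c zero) k (c i′ ∷ visited) (c i′)) → ⊥
    step-on (inj₂ t′) = stuck k (c i′ ∷ visited) i′ (trans (cong (_+ k) i′≡1+i) 1+i+k≡11) seen′ t′
    step-on (inj₁ again) with seen (∈ᶠ⇒∈ visited again)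
    ... | j , j≤i , cj≡ = <⇒≱ (≤-reflexive (≡-sym (trans (cong toℕ (c-inj cj≡)) i′≡1+i))) j≤i

earedAntiprism-connected : Connected earedAntiprism
earedAntiprism-connected u v = walk-++ (to-zero u) (walk-reverse (to-zero v))
  where
  G = earedAntiprism
  walk-++ : ∀ {u v w} → Walk G u v → Walk G v w → Walk G u w
  walk-++ here         q = q
  walk-++ (step u~x p) q = step u~x (walk-++ p q)
  walk-reverse : ∀ {u v} → Walk G u v → Walk G v u
  walk-reverse here         = here
  walk-reverse (step {u} {x} u~x p) = walk-++ (walk-reverse p) (step (Adj-sym G {u} {x} u~x) here)
  -- The parent map of a spanning tree of depth 3 rooted at 0.
  parent : Fin 12 → Fin 12
  parent = Vec.lookup (# 0 ∷ # 0 ∷ # 1 ∷ # 0 ∷ # 0 ∷ # 4 ∷ # 0 ∷ # 6 ∷ # 1 ∷ # 8 ∷ # 3 ∷ # 4 ∷ [])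
  climb : ∀ {u} → (parent u ≡ u ⊎ Adj G u (parent u)) → Walk G (parent u) zero → Walk G u zero
  climb (inj₁ eq)  p = subst (λ x → Walk G x zero) eq p
  climb (inj₂ u~p) p = step u~p p
  parent-adj : ∀ u → parent u ≡ u ⊎ Adj G u (parent u)
  parent-adj = toWitness {a? = Fin.all? λ u → (parent u Fin.≟ u) ⊎-dec T? _} _
  root : ∀ u → zero ≡ parent (parent (parent u))
  root = toWitness {a? = Fin.all? λ u → zero Fin.≟ parent (parent (parent u))} _
  to-zero : ∀ u → Walk G u zero
  -- The root is its own parent, so three steps end at 0 from every depth.
  to-zero u = climb (parent-adj u) (climb (parent-adj _) (climb (parent-adj _)
    (subst (λ x → Walk G x zero) (root u) here)))

theorem1 : ((n : ℕ) (G : Graph n) → 3 ≤ n → Connected G → LocallyLinear G → ¬ Hamiltonian G → 12 ≤ n)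
    × Σ (Graph 12) (λ G → Connected G × LocallyLinear G × ¬ Hamiltonian G)
theorem1 = (λ n G → order≥12 G)
  , earedAntiprism , earedAntiprism-connected , earedAntiprism-locallyLinear , earedAntiprism-nonhamiltonian
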